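{- Let $n\ge1$ and let $T$ be any binary tree with $n+1$ leaves. Then the pair of subsets $\mathcal G=\mathcal D_T$ and $\mathcal F=\mathcal A_T$ of the ball structure forms a torsion pair $(\mathcal G,\mathcal F)$.
   Context: A binary tree is a finite planar rooted tree in which every internal node has exactly two children. Let $T$ have $n+1$ leaves, numbered $0,1,\dots,n$ from left to right and drawn on the bottom level; the node whose subtree has leaves $i,i+1,\dots,j$ is drawn at the grid vertex $v_{i,j}=\left(\tfrac{i+j}{2},\tfrac{j-i}{2}\right)$. Edges of the tree are straight diagonal lines: descending (going down to the right; to right children, $j$ constant) or ascending (going up to the right; to left children, $i$ constant). Ball structure. The balls are indexed by pairs $[i,j]$ with $1\le i\le j\le n-1$; the ball $[i,j]$ fills the unit diamond with lowest corner $v_{i,j}$, left corner $v_{i-1,j}$, right corner $v_{i,j+1}$ and top corner $v_{i-1,j+1}$. (The balls represent the indecomposable objects of the category of representations of the linearly oriented quiver of type $A_{n-1}$; there are $n-1$ balls on the bottom row.) Hom. $\mathrm{Hom}(X,Y)\ne0$ if and only if the entire rectangle with left corner $X$ and right corner $Y$ lies in the ball structure; explicitly, $\mathrm{Hom}([i,j],[i',j'])\neq0$ if and only if $i\le i'\le j\le j'$. Torsion pair. A pair $(\mathcal G,\mathcal F)$ of subsets of balls is a torsion pair if $\mathcal G=\{X:\mathrm{Hom}(X,Y)=0\ \text{for all } Y\in\mathcal F\}$ and $\mathcal F=\{Y:\mathrm{Hom}(X,Y)=0\ \text{for all } X\in\mathcal G\}$. $\mathcal D_T$ is the set of balls sitting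 (directly) on descending edges of $T$: $[i,j]\in\mathcal D_T$ iff the lower-left side of its diamond, from $v_{i-1,j}$ to $v_{i,j}$, lies on a descending edge of $T$; equivalently, iff $a_j<i$, where $\{a_j,\dots,j\}$ is the leaf set of the largest subtree of $T$ whose rightmost leaf is $j$. $\mathcal A_T$ is the set of balls sitting on ascending edges of $T$: $[i,j]\in\mathcal A_T$ iff the lower-right side of its diamond, from $v_{i,j}$ to $v_{i,j+1}$, lies on an ascending edge of $T$; equivalently, iff $j<b_i$, where $\{i,\dots,b_i\}$ is the leaf set of the largest subtree of $T$ whose leftmost leaf is $i$. -}

module Defs where

open import Data.Nat using (ℕ; suc; _+_; _≤_; _<_)
open import Data.Product using (∃₂; _×_)
open import Data.Tree.Binary using (Tree; node; #leaves)
open import Data.Unit using (⊤)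
open import Level using (0ℓ)
open import Relation.Binary.Core using (Rel)
open import Relation.Nullary using (¬_)
open import Relation.Unary using (Pred; _∈_; _≐_)
open import Relation.Binary.PropositionalEquality using (_≡_)

BinaryTree : Set
BinaryTree = Tree ⊤ ⊤

-- SubtreeAt T i S: some node of T has subtree S, and the leftmost leaf of
-- S is leaf number i of T, the leaves being numbered 0, 1, … from the left.
data SubtreeAt : BinaryTree → ℕ → BinaryTree → Set where
  here  : ∀ {T} → SubtreeAt T 0 T
  left  : ∀ {l x r i S} → SubtreeAt l i S → SubtreeAt (node l x r) i S
  right : ∀ {l x r i S} → SubtreeAt r i S →
          SubtreeAt (node l x r) (#leaves l + i) S

-- The grid vertex v i j = ((i + j)/2 , (j - i)/2) is represented by the
-- indices i and j, which are determined by the coordinates.  A node whose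
-- subtree S starts at leaf i has leaf set {i,…,j}, where
-- suc j ≡ i + #leaves S, and is drawn at v i j.

-- The edge from the node at v a j down to its right child at v k j.
data DescendingEdge (T : BinaryTree) (a k j : ℕ) : Set where
  edge : ∀ {l x r} → SubtreeAt T a (node l x r) →
         k ≡ a + #leaves l → suc j ≡ k + #leaves r →
         DescendingEdge T a k j

-- The edge from the left child at v i k up to its parent at v i b.
data AscendingEdge (T : BinaryTree) (i k b : ℕ) : Set where
  edge : ∀ {l x r} → SubtreeAt T i (node l x r) →
         suc k ≡ i + #leaves l → suc b ≡ i + #leaves (node l x r) →
         AscendingEdge T i k b

-- The ball [ i , j ]; j < n says j ≤ n - 1.
record Ball (n : ℕ) : Set where
  field
    i j : ℕ
    1≤i : 1 ≤ i
    i≤j : i ≤ j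
    j<n : j < n

-- Hom(X,Y) ≠ 0.  The relation is decidable, so Hom(X,Y) = 0 is ¬ Hom≠0 X Y.
Hom≠0 : ∀ {n} → Rel (Ball n) 0ℓ
Hom≠0 X Y = X.i ≤ Y.i × Y.i ≤ X.j × X.j ≤ Y.j
  where
  module X = Ball X
  module Y = Ball Y

record IsTorsionPair {n : ℕ} (G F : Pred (Ball n) 0ℓ) : Set where
  field
    G≐ : G ≐ (λ X → ∀ Y → Y ∈ F → ¬ Hom≠0 X Y)
    F≐ : F ≐ (λ Y → ∀ X → X ∈ G → ¬ Hom≠0 X Y)

-- The lower-left side of the diamond of [ i , j ] runs from v (i - 1) j to
-- v i j.  It lies on the segment from v a j to v k j iff a ≤ i - 1 and i ≤ k.
𝒟 : ∀ {n} → BinaryTree → Pred (Ball n) 0ℓ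
𝒟 T X = ∃₂ λ a k → DescendingEdge T a k j × a < i × i ≤ k
  where open Ball X

-- The lower-right side of the diamond of [ i , j ] runs from v i j to
-- v i (j + 1).  It lies on the segment from v i k to v i b iff k ≤ j and
-- j + 1 ≤ b.
𝒜 : ∀ {n} → BinaryTree → Pred (Ball n) 0ℓ
𝒜 T X = ∃₂ λ k b → AscendingEdge T i k b × k ≤ j × j < b
  where open Ball X

{-# OPTIONS --safe #-}

-- Subtrees of T have laminar leaf sets.  A ball of 𝒟 T with a nonzero Hom to a
-- ball of 𝒜 T would give two subtrees with crossing leaf sets.  Conversely, let
-- {a,…,j} be the leaf set of the largest subtree with last leaf j < n.  Its root
-- is a left child, so [ a , j ] ∈ 𝒜 T; if [ i , j ] ∉ 𝒟 T then i ≤ a, and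
-- Hom([ i , j ] , [ a , j ]) ≠ 0.  The other half is dual, with the largest
-- subtree whose first leaf is i ≥ 1.

module Submission where

open import Defs
open import Data.Nat using (ℕ; zero; suc; _+_; _≤_; _<_; z≤n; s≤s; s≤s⁻¹)
open import Data.Nat.Properties
open import Data.Product using (∃; ∃₂; _×_; _,_)
open import Data.Sum using (_⊎_; inj₁; inj₂)
open import Data.Tree.Binary using (leaf; node; #leaves)
open import Data.Unit using (⊤)
open import Relation.Nullary using (¬_; contradiction)
open import Relation.Binary.PropositionalEquality
  using (_≡_; refl; sym; trans; cong; subst; subst₂; module ≡-Reasoning)

-- Provides `m`, the number of the last leaf, in the form that `AscendingEdge` asks for.
#leaves-pred : ∀ (T : BinaryTree) → ∃ λ m → suc m ≡ #leaves T
#leaves-pred (leaf _) = 0 , refl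
#leaves-pred (node l _ r) with #leaves-pred l
... | m , eq = m + #leaves r , cong (_+ #leaves r) eq

SubtreeAt-bound : ∀ {T i S} → SubtreeAt T i S → i + #leaves S ≤ #leaves T
SubtreeAt-bound here = ≤-refl
SubtreeAt-bound {node l _ r} (left s) =
  ≤-trans (SubtreeAt-bound s) (m≤m+n (#leaves l) (#leaves r))
SubtreeAt-bound {node l _ r} {S = S} (right {i = i} s) = begin
  #leaves l + i + #leaves S   ≡⟨ +-assoc (#leaves l) i (#leaves S) ⟩
  #leaves l + (i + #leaves S) ≤⟨ +-monoʳ-≤ (#leaves l) (SubtreeAt-bound s) ⟩
  #leaves l + #leaves r       ∎
  where open ≤-Reasoning

-- Two subtrees in the same child are handled by induction. In different children they occupy
-- disjoint intervals, against `a < i` or `i < a + #leaves S`. If `S` is all of `T`, nothing ends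
-- after it; `R` cannot be all of `T`, since `a < i` makes `i` positive.
SubtreeAt-noncrossing : ∀ {T a i S R} → SubtreeAt T a S → SubtreeAt T i R →
  a < i → i < a + #leaves S → ¬ (a + #leaves S < i + #leaves R)
SubtreeAt-noncrossing here t _ _ c = <⇒≱ c (SubtreeAt-bound t)
SubtreeAt-noncrossing (left s) (left t) a<i i<e c =
  SubtreeAt-noncrossing s t a<i i<e c
SubtreeAt-noncrossing (left s) (right t) _ i<e _ =
  <⇒≱ i<e (≤-trans (SubtreeAt-bound s) (m≤m+n _ _))
SubtreeAt-noncrossing {i = i} {R = R} (right s) (left t) a<i _ _ =
  <⇒≱ a<i (≤-trans (m+n≤o⇒m≤o i (SubtreeAt-bound t)) (m≤m+n _ _))
SubtreeAt-noncrossing {node l _ _} {S = S} {R = R}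
  (right {i = a} s) (right {i = i} t) a<i i<e c =
  SubtreeAt-noncrossing s t
    (+-cancelˡ-< p a i a<i)
    (+-cancelˡ-< p i (a + #leaves S) (subst (p + i <_) (+-assoc p a (#leaves S)) i<e))
    (+-cancelˡ-< p (a + #leaves S) (i + #leaves R)
      (subst₂ _<_ (+-assoc p a (#leaves S)) (+-assoc p i (#leaves R)) c))
  where p = #leaves l

-- `𝒟`, and below it `𝒜`, on bare indices: induction can shift them into a subtree without carrying
-- the bounds of a ball.
OnDescending : BinaryTree → ℕ → ℕ → Set
OnDescending T i j = ∃₂ λ a k → DescendingEdge T a k j × a < i × i ≤ k

OnAscending : BinaryTree → ℕ → ℕ → Set
OnAscending T i j = ∃₂ λ k b → AscendingEdge T i k b × k ≤ j × j < b

suc-shift : ∀ p {j m n} → suc j ≡ m + n → suc (p + j) ≡ p + m + n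
suc-shift p {j} {m} {n} eq = begin
  suc (p + j) ≡⟨ +-suc p j ⟨
  p + suc j   ≡⟨ cong (p +_) eq ⟩
  p + (m + n) ≡⟨ +-assoc p m n ⟨
  p + m + n   ∎
  where open ≡-Reasoning

module _ {l r : BinaryTree} {x : ⊤} where

  private p = #leaves l

  descending-left : ∀ {i j} → OnDescending l i j → OnDescending (node l x r) i j
  descending-left (a , k , edge s eqk eqj , a<i , i≤k) =
    a , k , edge (left s) eqk eqj , a<i , i≤k

  descending-right : ∀ {i j} → OnDescending r i j →
    OnDescending (node l x r) (p + i) (p + j)
  descending-right (a , k , edge s eqk eqj , a<i , i≤k) =
    p + a , p + k ,
    edge (right s) (trans (cong (p +_) eqk) (sym (+-assoc p a _))) (suc-shift p eqj) ,
    +-monoʳ-< p a<i , +-monoʳ-≤ p i≤k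

  ascending-left : ∀ {i j} → OnAscending l i j → OnAscending (node l x r) i j
  ascending-left (k , b , edge s eqk eqb , k≤j , j<b) =
    k , b , edge (left s) eqk eqb , k≤j , j<b

  ascending-right : ∀ {i j} → OnAscending r i j →
    OnAscending (node l x r) (p + i) (p + j)
  ascending-right (k , b , edge s eqk eqb , k≤j , j<b) =
    p + k , p + b , edge (right s) (suc-shift p eqk) (suc-shift p eqb) ,
    +-monoʳ-≤ p k≤j , +-monoʳ-< p j<b

-- The descending edges of the right spine join up into one segment from `v 0 j` to `v j j`. The
-- root edge covers `i ≤ #leaves l`; larger `i` are found in `r`.
descending-last : ∀ {T i j} → 1 ≤ i → i ≤ j → suc j ≡ #leaves T → OnDescending T i j
descending-last {leaf _} 1≤i i≤j refl = contradiction i≤j (<⇒≱ 1≤i)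
descending-last {node l _ r} {i} {j} 1≤i i≤j eq with ≤-<-connex i (#leaves l)
... | inj₁ i≤p = 0 , #leaves l , edge here refl eq , 1≤i , i≤p
... | inj₂ p<i with m≤n⇒∃[o]m+o≡n (<⇒≤ p<i)
...   | i′ , refl with m≤n⇒∃[o]m+o≡n (m+n≤o⇒m≤o (#leaves l) i≤j)
...     | j′ , refl = descending-right (descending-last
  (+-cancelˡ-< p 0 i′ (subst (_< p + i′) (sym (+-identityʳ p)) p<i))
  (+-cancelˡ-≤ p i′ j′ i≤j)
  (+-cancelˡ-≡ p (suc j′) (#leaves r) (trans (+-suc p j′) eq)))
  where p = #leaves l

-- Dually, the left spine runs from `v 0 0` up to the root, so it contains the step from `j` to
-- `j + 1` whenever `j` is not the last leaf.
ascending-first : ∀ {T j} → suc j < #leaves T → OnAscending T 0 j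
ascending-first {leaf _} (s≤s ())
ascending-first {node l _ r} {j} j<n with <-≤-connex (suc j) (#leaves l)
... | inj₁ j<p = ascending-left (ascending-first j<p)
... | inj₂ p≤j with #leaves-pred l | #leaves-pred (node l _ r)
...   | k , eqk | b , eqb =
  k , b , edge here eqk eqb ,
  s≤s⁻¹ (subst (_≤ suc j) (sym eqk) p≤j) ,
  s≤s⁻¹ (subst (suc j <_) (sym eqb) j<n)

+-cancelˡ-<-suc : ∀ p {j n} → suc (p + j) < p + n → suc j < n
+-cancelˡ-<-suc p {j} {n} lt =
  +-cancelˡ-< p (suc j) n (subst (_< p + n) (sym (+-suc p j)) lt)

descending-or-ascending : ∀ {T i j} → i ≤ j → suc j < #leaves T →
  OnDescending T i j ⊎ ∃ λ a → i ≤ a × a ≤ j × OnAscending T a j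
descending-or-ascending {leaf _} _ (s≤s ())
descending-or-ascending {node l _ r} {i} {j} i≤j j<n
  with <-≤-connex j (#leaves l)
descending-or-ascending {node l _ r} {i} {j} i≤j j<n | inj₁ j<p
  with m≤n⇒m<n∨m≡n j<p
... | inj₁ 1+j<p with descending-or-ascending {l} i≤j 1+j<p
...   | inj₁ d = inj₁ (descending-left d)
...   | inj₂ (a , i≤a , a≤j , t) = inj₂ (a , i≤a , a≤j , ascending-left t)
-- Here `l` is the largest subtree with last leaf `j`. It starts at leaf 0, so for `i = 0` the
-- witness is `a = 0`.
descending-or-ascending {node l _ r} {zero} {j} _ j<n | inj₁ _ | inj₂ _ =
  inj₂ (0 , z≤n , z≤n , ascending-first j<n)
descending-or-ascending {node l _ r} {suc i} {j} i≤j _ | inj₁ _ | inj₂ 1+j≡p =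
  inj₁ (descending-left (descending-last (s≤s z≤n) i≤j 1+j≡p))
descending-or-ascending {node l _ r} {i} {j} i≤j j<n | inj₂ p≤j
  with m≤n⇒∃[o]m+o≡n p≤j | ≤-total i (#leaves l)
... | j′ , refl | inj₁ i≤p =
  -- Leaf `j` lies in `r` but is not its last, so the left spine of `r` carries [ p , j ]. Any such
  -- ball will do; `p` need not start the largest subtree ending at `j`.
  inj₂ (p + 0 , ≤-trans i≤p (m≤m+n p 0) , +-monoʳ-≤ p z≤n ,
        ascending-right (ascending-first (+-cancelˡ-<-suc p j<n)))
  where p = #leaves l
... | j′ , refl | inj₂ p≤i with m≤n⇒∃[o]m+o≡n p≤i
...   | i′ , refl
  with descending-or-ascending {r} (+-cancelˡ-≤ (#leaves l) i′ j′ i≤j)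
         (+-cancelˡ-<-suc (#leaves l) j<n)
...     | inj₁ d = inj₁ (descending-right d)
...     | inj₂ (a , i≤a , a≤j , t) =
  inj₂ (p + a , +-monoʳ-≤ p i≤a , +-monoʳ-≤ p a≤j , ascending-right t)
  where p = #leaves l

ascending-or-descending : ∀ {T i j} → 1 ≤ i → i ≤ j → j < #leaves T →
  OnAscending T i j ⊎ ∃ λ b → i ≤ b × b ≤ j × OnDescending T i b
ascending-or-descending {leaf _} 1≤i i≤j j<1 =
  contradiction (≤-trans 1≤i i≤j) (<⇒≱ j<1)
ascending-or-descending {node l _ r} {i} {j} 1≤i i≤j j<n
  with <-≤-connex i (#leaves l)
... | inj₁ i<p with <-≤-connex j (#leaves l)
...   | inj₂ p≤j with #leaves-pred l
...     | m , eq =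
  -- The last leaf `m` of `l` is the witness: as `1 ≤ i`, the right spine of `l` carries [ i , m ].
  inj₂ (m , i≤m , ≤-trans (n≤1+n m) (subst (_≤ j) (sym eq) p≤j) ,
        descending-left (descending-last 1≤i i≤m eq))
  where i≤m = s≤s⁻¹ (subst (i <_) (sym eq) i<p)
ascending-or-descending {node l _ r} 1≤i i≤j j<n | inj₁ i<p | inj₁ j<p
  with ascending-or-descending {l} 1≤i i≤j j<p
... | inj₁ t = inj₁ (ascending-left t)
... | inj₂ (b , i≤b , b≤j , d) = inj₂ (b , i≤b , b≤j , descending-left d)
ascending-or-descending {node l _ r} {i} {j} 1≤i i≤j j<n | inj₂ p≤i
  with m≤n⇒∃[o]m+o≡n p≤i | m≤n⇒∃[o]m+o≡n (≤-trans p≤i i≤j)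
... | zero , refl | j′ , refl
  with m≤n⇒m<n∨m≡n (+-cancelˡ-< (#leaves l) j′ (#leaves r) j<n)
...   | inj₁ 1+j<n = inj₁ (ascending-right (ascending-first 1+j<n))
...   | inj₂ 1+j≡n =
  -- Now `r` has leaf set {i,...,j} and is the largest subtree starting at `i`; the witness is
  -- `b = j`, on the right spine of the whole tree.
  inj₂ (_ , i≤j , ≤-refl ,
        descending-last 1≤i i≤j (trans (sym (+-suc p j′)) (cong (p +_) 1+j≡n)))
  where p = #leaves l
ascending-or-descending {node l _ r} 1≤i i≤j j<n | inj₂ p≤i
    | suc i′ , refl | j′ , refl
  with ascending-or-descending {r} (s≤s z≤n)
         (+-cancelˡ-≤ (#leaves l) (suc i′) j′ i≤j)
         (+-cancelˡ-< (#leaves l) j′ (#leaves r) j<n)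
... | inj₁ t = inj₁ (ascending-right t)
... | inj₂ (b , i≤b , b≤j , d) =
  inj₂ (p + b , +-monoʳ-≤ p i≤b , +-monoʳ-≤ p b≤j , descending-right d)
  where p = #leaves l

-- The parents of the two edges have leaf sets {a,...,j} and {i′,...,b}, and these cross because a <
-- i ≤ i′ ≤ j ≤ j′ < b.
𝒟-𝒜-orthogonal : ∀ {n} T (X Y : Ball n) → 𝒟 T X → 𝒜 T Y → ¬ Hom≠0 X Y
𝒟-𝒜-orthogonal T X Y
  (a , k , edge {l} {x} {r} s eqk eqj , a<i , _) (_ , b , edge t _ eqb , _ , j′<b)
  (i≤i′ , i′≤j , j≤j′) =
  SubtreeAt-noncrossing s t (<-≤-trans a<i i≤i′)
    (subst (Ball.i Y <_) end (s≤s i′≤j))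
    (subst₂ _<_ end eqb (s≤s (≤-<-trans j≤j′ j′<b)))
  where
  end : suc (Ball.j X) ≡ a + (#leaves l + #leaves r)
  end = trans eqj (trans (cong (_+ #leaves r) eqk) (+-assoc a (#leaves l) (#leaves r)))

theorem4p5 : (n : ℕ) → 1 ≤ n → (T : BinaryTree) → #leaves T ≡ suc n → IsTorsionPair {n} (𝒟 T) (𝒜 T)
theorem4p5 n _ T #T≡1+n = record
  { G≐ = (λ {X} d Y t → 𝒟-𝒜-orthogonal T X Y d t) , λ {X} → in-𝒟 X
  ; F≐ = (λ {Y} t X d → 𝒟-𝒜-orthogonal T X Y d t) , λ {Y} → in-𝒜 Y
  }
  where
  in-𝒟 : ∀ X → (∀ Y → 𝒜 T Y → ¬ Hom≠0 X Y) → 𝒟 T X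
  in-𝒟 X orth
    -- The bound `j < n` says that `j` comes before the last leaf, which has number `n`.
    with descending-or-ascending (Ball.i≤j X) (subst (suc (Ball.j X) <_) (sym #T≡1+n) (s≤s (Ball.j<n X)))
  ... | inj₁ d = d
  ... | inj₂ (a , i≤a , a≤j , t) = contradiction (i≤a , a≤j , ≤-refl) (orth Y t)
    where
    Y : Ball n
    Y = record { i = a ; j = Ball.j X ; 1≤i = ≤-trans (Ball.1≤i X) i≤a ; i≤j = a≤j ; j<n = Ball.j<n X }

  in-𝒜 : ∀ Y → (∀ X → 𝒟 T X → ¬ Hom≠0 X Y) → 𝒜 T Y
  in-𝒜 Y orth
    with ascending-or-descending (Ball.1≤i Y) (Ball.i≤j Y)
           (subst (Ball.j Y <_) (sym #T≡1+n) (<-trans (Ball.j<n Y) (n<1+n n)))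
  ... | inj₁ t = t
  ... | inj₂ (b , i≤b , b≤j , d) = contradiction (≤-refl , i≤b , b≤j) (orth X d)
    where
    X : Ball n
    X = record { i = Ball.i Y ; j = b ; 1≤i = Ball.1≤i Y ; i≤j = i≤b ; j<n = ≤-<-trans b≤j (Ball.j<n Y) }
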